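{- Every graph with minor-matching hypertreewidth $k$ has sim-width at most $k$.
   Context: A tree decomposition of $G$ is a pair $(T,\mathrm{bag})$, $T$ a tree, $\mathrm{bag}: V(T)\to 2^{V(G)}$, such that every edge of $G$ lies inside some bag and for each vertex $v$ the nodes whose bags contain $v$ form a non-empty connected subtree. For $X\subseteq V(G)$, $\mu(X)$ is the maximum size of an induced matching $M$ of $G$ (the subgraph induced by the endpoints of $M$ has no edges besides $M$) such that every edge of $M$ has at least one endpoint in $X$. The minor-matching hypertreewidth of $G$ is the minimum over tree decompositions of $\max_t \mu(\mathrm{bag}(t))$. For $A\subseteq V(G)$, $\overline{A}=V(G)\setminus A$ and $\mathrm{sw}(A)$ is the maximum size of an induced matching of $G$ each of whose edges has one endpoint in $A$ and one in $\overline{A}$. A branch decomposition of $V(G)$ is $(T,\delta)$ with $T$ a tree whose internal nodes have degree 3 and $\delta$ a bijection from $V(G)$ to its leaves; each tree edge gives a bipartition $(A,\overline{A})$ of $V(G)$ with width $\mathrm{sw}(A)$; the sim-width of $G$ is the minimum over branch decompositions of the maximum edge width. -}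

module Defs where

open import Data.Nat using (ℕ; zero; suc; _≤_; _≡ᵇ_)
open import Data.Bool using (Bool; true; false)
open import Data.Fin using (Fin; zero; suc; inject₁; fromℕ)
open import Data.Fin.Subset using (Subset; _∈_; ∣_∣)
open import Data.Vec using (tabulate)
open import Data.Product using (Σ; ∃; ∃-syntax; _×_; _,_)
open import Data.Sum using (_⊎_)
open import Relation.Nullary using (¬_)
open import Relation.Binary.PropositionalEquality using (_≡_; _≢_)
open import Function.Definitions using (Injective)

record Graph (n : ℕ) : Set where
  field
    adj   : Fin n → Fin n → Bool
    sym   : ∀ u v → adj u v ≡ adj v u
    irrefl : ∀ v → adj v v ≡ false

open Graph public

E : ∀ {n} → Graph n → Fin n → Fin n → Set
E G u v = adj G u v ≡ true

degree : ∀ {n} → Graph n → Fin n → ℕ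
degree G v = ∣ tabulate (adj G v) ∣

data Walk {n} (G : Graph n) : Fin n → Fin n → Set where
  []   : ∀ {x} → Walk G x x
  _∷_  : ∀ {x y z} → E G x y → Walk G y z → Walk G x z

AllOn : ∀ {n} {G : Graph n} → (Fin n → Set) → ∀ {x y} → Walk G x y → Set
AllOn P {x} []       = P x
AllOn P {x} (_ ∷ w)  = P x × AllOn P w

Avoids : ∀ {n} {G : Graph n} → Fin n → Fin n → ∀ {x y} → Walk G x y → Set
Avoids a b []            = Data.Unit.⊤
  where import Data.Unit
Avoids a b (_∷_ {x} {y} _ w) = ¬ (x ≡ a × y ≡ b) × ¬ (x ≡ b × y ≡ a) × Avoids a b w

ConnectedOn : ∀ {n} → Graph n → (Fin n → Set) → Set
ConnectedOn G S = ∀ x y → S x → S y → Σ (Walk G x y) (AllOn S)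

Connected : ∀ {n} → Graph n → Set
Connected G = ∀ x y → Walk G x y

record Cycle {n} (G : Graph n) : Set where
  field
    m       : ℕ
    c       : Fin (suc (suc (suc m))) → Fin n
    inj     : Injective _≡_ _≡_ c
    steps   : ∀ (i : Fin (suc (suc m))) → E G (c (inject₁ i)) (c (suc i))
    closing : E G (c (fromℕ (suc (suc m)))) (c zero)

record Tree : Set where
  field
    size      : ℕ
    graph     : Graph (suc size)
    connected : Connected graph
    acyclic   : ¬ Cycle graph

  Node : Set
  Node = Fin (suc size)

record InducedMatching {n} (G : Graph n) (m : ℕ) : Set where
  field
    u w      : Fin m → Fin n
    isEdge   : ∀ i → E G (u i) (w i)
    distinct : ∀ i j → i ≢ j →
               u i ≢ u j × u i ≢ w j × w i ≢ u j × w i ≢ w j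
    noEdge   : ∀ i j → i ≢ j →
               ¬ E G (u i) (u j) × ¬ E G (u i) (w j) ×
               ¬ E G (w i) (u j) × ¬ E G (w i) (w j)

open InducedMatching public

Touches : ∀ {n} {G : Graph n} {m} → InducedMatching G m → Subset n → Set
Touches M X = ∀ i → u M i ∈ X ⊎ w M i ∈ X

μ≤ : ∀ {n} → Graph n → Subset n → ℕ → Set
μ≤ G X k = ∀ m (M : InducedMatching G m) → Touches M X → m ≤ k

μ≥ : ∀ {n} → Graph n → Subset n → ℕ → Set
μ≥ G X k = ∃[ m ] (k ≤ m × Σ (InducedMatching G m) λ M → Touches M X)

record TreeDecomposition {n} (G : Graph n) : Set₁ where
  field
    tree      : Tree
  open Tree tree
  field
    bag       : Node → Subset n
    edgeCov   : ∀ x y → E G x y → ∃[ s ] (x ∈ bag s × y ∈ bag s)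
    nonempty  : ∀ v → ∃[ s ] (v ∈ bag s)
    coherent  : ∀ v → ConnectedOn graph (λ s → v ∈ bag s)

MMHW≡ : ∀ {n} → Graph n → ℕ → Set₁
MMHW≡ G k =
  (Σ (TreeDecomposition G) λ D → ∀ s → μ≤ G (TreeDecomposition.bag D s) k) ×
  (∀ (D : TreeDecomposition G) → ∃[ s ] μ≥ G (TreeDecomposition.bag D s) k)

sw≤ : ∀ {n} → Graph n → (Fin n → Set) → ℕ → Set
sw≤ G A k = ∀ m (M : InducedMatching G m) →
  (∀ i → (A (u M i) × ¬ A (w M i)) ⊎ (A (w M i) × ¬ A (u M i))) → m ≤ k

record BranchDecomposition {n} (G : Graph n) : Set where
  field
    tree     : Tree
  open Tree tree
  Leaf : Node → Set
  Leaf s = degree graph s ≤ 1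
  field
    internal : ∀ s → ¬ Leaf s → degree graph s ≡ 3
    δ        : Fin n → Node
    δ-inj    : Injective _≡_ _≡_ δ
    δ-leaf   : ∀ v → Leaf (δ v)
    δ-onto   : ∀ s → Leaf s → ∃[ v ] (δ v ≡ s)

  -- for a tree edge {a , b}: the side A of the bipartition containing a,
  -- i.e. the vertices v whose leaf δ v reaches a without using the edge {a , b}
  side : Node → Node → Fin n → Set
  side a b v = Σ (Walk graph (δ v) a) (Avoids a b)

SimWidth≤ : ∀ {n} → Graph n → ℕ → Set
SimWidth≤ G k = Σ (BranchDecomposition G) λ B →
  let open BranchDecomposition B
      open Tree tree
  in ∀ a b → E graph a b → sw≤ G (side a b) k

{-# OPTIONS --safe #-}
module Submission where

open import Defs
open import Data.Nat using (ℕ; zero; suc; _+_; _∸_; _≤_; _<_; z≤n; s≤s)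
open import Data.Nat.Properties using (≤-reflexive; +-suc; +-assoc; +-identityʳ; n<1+n;
  m+[n∸m]≡n; m∸n≤m; <⇒≤; ≤-<-trans; m<n⇒0<n∸m; <-cmp)
open import Data.Nat.Induction using (<-wellFounded)
open import Data.Bool using (Bool; true; false; not; if_then_else_)
open import Data.Bool.Properties using () renaming (_≟_ to _≟ᵇ_)
open import Data.Unit using (tt)
open import Data.Fin using (Fin; zero; suc; toℕ; fromℕ; inject₁)
open import Data.Fin.Properties using (_≟_; any?; all?; ¬∀⟶∃¬; pigeonhole;
  toℕ-inject₁; toℕ-fromℕ; toℕ-injective; toℕ<n; suc-injective)
open import Data.Fin.Subset using (Subset; ∣_∣; _⊂_) renaming (_∈_ to _∈ˢ_; _∉_ to _∉ˢ_)
open import Data.Fin.Subset.Properties using () renaming (_∈?_ to _∈ˢ?_)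
open import Data.Fin.Subset.Induction using (⊂-wellFounded)
open import Data.List using ([]; _∷_; allFin)
open import Data.List.Membership.Propositional using (_∈_)
open import Data.List.Membership.Propositional.Properties using (∈-allFin)
open import Data.List.Relation.Unary.Any using (here; there)
open import Data.Product using (Σ; ∃; ∃-syntax; _×_; _,_; proj₁; proj₂)
open import Data.Sum using (_⊎_; inj₁; inj₂; [_,_]′)
import Data.Sum as Sum
open import Data.Vec using (tabulate)
open import Data.Vec.Properties using (lookup∘tabulate; lookup⇒[]=; []=⇒lookup)
open import Function using (_∘_; id; case_of_)
open import Induction.WellFounded using (Acc; acc)
open import Relation.Binary.Definitions using (tri<; tri≈; tri>)
open import Relation.Binary.PropositionalEquality using (_≡_; _≢_; refl; trans; cong; subst; subst₂)
  renaming (sym to ≡-sym)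
open import Relation.Nullary using (¬_; yes; no; does; contradiction; ¬?; _×-dec_; _→-dec_)
open import Relation.Nullary.Decidable using (dec-true; dec-false; decidable-stable)
open import Relation.Unary using (Decidable; _≐_; _∪_; ∁)

-- Root every vertex x of G at a node home x of T with x in its bag, and contract T one node at a
-- time. If A is the set of vertices rooted in one of the contracted parts, with representative
-- p, then every edge of G between A and its complement has an end in bag p, because the nodes
-- whose bags contain a given vertex can leave the part only through p. An induced matching
-- across A is therefore bounded by μ (bag p). Merging parts, and at the start
-- the vertices of one bag, two at a time yields a binary hierarchy of clusters with this
-- bound, and the clusters are the sides of the edges of a cubic tree, grown top-down
-- by attaching pendant vertices. A node with at most one neighbouring part can always be
-- merged; if there were none, T would have arbitrarily long non-backtracking walks, hence a cycle.

-- Walks, and the cut bound under equivalence and complement.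

E-sym : ∀ {m} (H : Graph m) {x y} → E H x y → E H y x
E-sym H {x} {y} e = trans (sym H y x) e

E⇒≢ : ∀ {m} (H : Graph m) {x y} → E H x y → x ≢ y
E⇒≢ H {x} e refl with trans (≡-sym e) (irrefl H x)
... | ()

_++ʷ_ : ∀ {m} {H : Graph m} {x y z} → Walk H x y → Walk H y z → Walk H x z
[]      ++ʷ q = q
(e ∷ p) ++ʷ q = e ∷ (p ++ʷ q)

module _ {n} {G : Graph n} {k : ℕ} where

  sw≤-resp : ∀ {P Q : Fin n → Set} → P ≐ Q → sw≤ G P k → sw≤ G Q k
  sw≤-resp (P⊆Q , Q⊆P) h m M crosses = h m M λ i →
    Sum.map (λ (p , q) → Q⊆P p , q ∘ P⊆Q) (λ (p , q) → Q⊆P p , q ∘ P⊆Q) (crosses i)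

  -- An edge crosses a set exactly when it crosses the complement. Decidability of `P` removes the
  -- double negation that complementing twice leaves behind.
  sw≤-∁ : ∀ {P : Fin n → Set} → Decidable P → sw≤ G P k → sw≤ G (∁ P) k
  sw≤-∁ P? h m M crosses = h m M λ i →
    Sum.map (λ (¬p , ¬¬q) → decidable-stable (P? _) ¬¬q , ¬p)
            (λ (¬p , ¬¬q) → decidable-stable (P? _) ¬¬q , ¬p)
            (Sum.swap (crosses i))

-- A two-colouring of the vertices that changes only along the edge {a , b}. Having one for every
-- edge rules out cycles, and the colour classes are the two sides of the edge.
record Bridge {m} (H : Graph m) (a b : Fin m) : Set where
  field
    side   : Fin m → Bool
    side-a : side a ≡ true
    side-b : side b ≡ false
    cross  : ∀ x y → E H x y → side x ≡ side y ⊎ (x ≡ a × y ≡ b) ⊎ (x ≡ b × y ≡ a)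

open Bridge

reverse : ∀ {m} {H : Graph m} {a b} → Bridge H a b → Bridge H b a
reverse β = record
  { side   = not ∘ side β
  ; side-a = cong not (side-b β)
  ; side-b = cong not (side-a β)
  ; cross  = λ x y e → Sum.map (cong not) Sum.swap (cross β x y e)
  }

module _ {m} {H : Graph m} {a b : Fin m} (β : Bridge H a b) where

  walk⇒side : ∀ {x} (w : Walk H x a) → Avoids a b w → side β x ≡ true
  walk⇒side []                  _ = side-a β
  walk⇒side (_∷_ {x} {y} e w) (¬ab , ¬ba , av) with cross β x y e
  ... | inj₁ eq         = trans eq (walk⇒side w av)
  ... | inj₂ (inj₁ ab)  = contradiction ab ¬ab
  ... | inj₂ (inj₂ ba)  = contradiction ba ¬ba

  -- The walk is cut at its first visit to `a`. Before that its colour stays `true`, so it never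
  -- meets `b` and cannot use the edge between them.
  side⇒walk : ∀ {x} → Walk H x a → side β x ≡ true → Σ (Walk H x a) (Avoids a b)
  side⇒walk []                _ = [] , tt
  side⇒walk (_∷_ {x} {y} e w) s with x ≟ a | x ≟ b
  ... | yes refl | _        = [] , tt
  ... | no _     | yes refl = contradiction (trans (≡-sym s) (side-b β)) λ ()
  ... | no x≢a   | no x≢b   with cross β x y e
  ...   | inj₂ (inj₁ (x≡a , _)) = contradiction x≡a x≢a
  ...   | inj₂ (inj₂ (x≡b , _)) = contradiction x≡b x≢b
  ...   | inj₁ eq with side⇒walk w (trans (≡-sym eq) s)
  ...     | w′ , av = e ∷ w′ , x≢a ∘ proj₁ , x≢b ∘ proj₁ , av

fin-constant : ∀ {ℓ} {A : Set ℓ} {m} (f : Fin (suc m) → A) →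
               (∀ i → f (inject₁ i) ≡ f (suc i)) → f zero ≡ f (fromℕ m)
fin-constant {m = zero}  f h = refl
fin-constant {m = suc m} f h =
  trans (h zero) (fin-constant (f ∘ suc) (h ∘ suc))

-- The bridge of the closing edge gives its ends different colours, while the other edges of the
-- cycle, being different from it, preserve the colour all the way round.
bridges⇒acyclic : ∀ {m} {H : Graph m} → (∀ {a b} → E H a b → Bridge H a b) → ¬ Cycle H
bridges⇒acyclic {H = H} bridge C =
  contradiction (trans (≡-sym (side-b β)) (trans (fin-constant (side β ∘ c) step) (side-a β))) λ ()
  where
  open Cycle C
  β = bridge closing
  step : ∀ i → side β (c (inject₁ i)) ≡ side β (c (suc i))
  step i with cross β _ _ (steps i)
  ... | inj₁ eq                = eq
  ... | inj₂ (inj₁ (_ , q))    = contradiction (inj q) λ ()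
  -- Such a step would start at the first vertex of the cycle and end at the last one, which is
  -- impossible because a cycle has at least three vertices.
  ... | inj₂ (inj₂ (p , q))    with i | inj p | inj q
  ...   | zero  | _  | ()
  ...   | suc _ | () | _

-- Pendant vertices

pendant : ∀ {m} → Graph m → Fin m → Graph (suc m)
pendant H x = record { adj = adj′ ; sym = sym′ ; irrefl = irrefl′ }
  where
  adj′ : Fin _ → Fin _ → Bool
  adj′ zero    zero    = false
  adj′ zero    (suc y) = does (x ≟ y)
  adj′ (suc y) zero    = does (x ≟ y)
  adj′ (suc y) (suc z) = adj H y z
  sym′ : ∀ u v → adj′ u v ≡ adj′ v u
  sym′ zero    zero    = refl
  sym′ zero    (suc _) = refl
  sym′ (suc _) zero    = refl
  sym′ (suc y) (suc z) = sym H y z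
  irrefl′ : ∀ v → adj′ v v ≡ false
  irrefl′ zero    = refl
  irrefl′ (suc v) = irrefl H v

does⇒≡ : ∀ {m} {x y : Fin m} → does (x ≟ y) ≡ true → x ≡ y
does⇒≡ {x = x} {y} e with x ≟ y
... | yes p = p
does⇒≡ () | no _

∣tabulate-false∣ : ∀ m → ∣ tabulate {n = m} (λ _ → false) ∣ ≡ 0
∣tabulate-false∣ zero    = refl
∣tabulate-false∣ (suc m) = ∣tabulate-false∣ m

∣tabulate-≟∣ : ∀ {m} (x : Fin m) → ∣ tabulate (λ y → does (x ≟ y)) ∣ ≡ 1
∣tabulate-≟∣ {suc m} zero = cong suc (∣tabulate-false∣ m)
∣tabulate-≟∣ (suc x)      = ∣tabulate-≟∣ x

module _ {m} (H : Graph m) (x : Fin m) where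

  private H⁺ = pendant H x

  degree-pendant : degree H⁺ zero ≡ 1
  degree-pendant = ∣tabulate-≟∣ x

  degree-support : degree H⁺ (suc x) ≡ suc (degree H x)
  degree-support rewrite dec-true (x ≟ x) refl = refl

  degree-other : ∀ {y} → y ≢ x → degree H⁺ (suc y) ≡ degree H y
  degree-other {y} y≢x rewrite dec-false (x ≟ y) (y≢x ∘ ≡-sym) = refl

  pendant-edge : E H⁺ zero (suc x)
  pendant-edge = dec-true (x ≟ x) refl

  liftʷ : ∀ {y z} → Walk H y z → Walk H⁺ (suc y) (suc z)
  liftʷ []      = []
  liftʷ (e ∷ w) = e ∷ liftʷ w

  pendant-connected : Connected H → Connected H⁺
  pendant-connected conn zero    zero    = []
  pendant-connected conn zero    (suc z) = pendant-edge ∷ liftʷ (conn x z)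
  pendant-connected conn (suc y) zero    =
    liftʷ (conn y x) ++ʷ (pendant-edge ∷ [])
  pendant-connected conn (suc y) (suc z) = liftʷ (conn y z)

  -- The new vertex inherits the colour of `x`, so the new edge is monochromatic.
  lift-bridge : ∀ {a b} → Bridge H a b → Bridge H⁺ (suc a) (suc b)
  lift-bridge {a} {b} β = record
    { side = side⁺ ; side-a = side-a β ; side-b = side-b β ; cross = cross⁺ }
    where
    side⁺ : Fin (suc m) → Bool
    side⁺ zero    = side β x
    side⁺ (suc y) = side β y
    cross⁺ : ∀ y z → E H⁺ y z →
             side⁺ y ≡ side⁺ z ⊎ (y ≡ suc a × z ≡ suc b) ⊎ (y ≡ suc b × z ≡ suc a)
    cross⁺ zero    (suc z) e = inj₁ (cong (side β) (does⇒≡ {x = x} e))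
    cross⁺ (suc y) zero    e = inj₁ (cong (side β) (≡-sym (does⇒≡ {x = x} e)))
    cross⁺ (suc y) (suc z) e =
      Sum.map₂ (Sum.map (λ (p , q) → cong suc p , cong suc q)
                        (λ (p , q) → cong suc p , cong suc q)) (cross β y z e)

  pendant-bridge : Bridge H⁺ zero (suc x)
  pendant-bridge = record
    { side = side⁺ ; side-a = refl ; side-b = refl ; cross = cross⁺ }
    where
    side⁺ : Fin (suc m) → Bool
    side⁺ zero    = true
    side⁺ (suc _) = false
    cross⁺ : ∀ y z → E H⁺ y z →
             side⁺ y ≡ side⁺ z ⊎ (y ≡ zero × z ≡ suc x) ⊎ (y ≡ suc x × z ≡ zero)
    cross⁺ zero    (suc z) e = inj₂ (inj₁ (refl , cong suc (≡-sym (does⇒≡ {x = x} e))))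
    cross⁺ (suc y) zero    e = inj₂ (inj₂ (cong suc (≡-sym (does⇒≡ {x = x} e)) , refl))
    cross⁺ (suc y) (suc z) e = inj₁ refl

-- Growing a branch decomposition

module _ {n} (G : Graph n) (k : ℕ) where

  -- An unfinished branch decomposition: many vertices may still share a node. The bridges serve
  -- both as the certificate of acyclicity and as the description of the cuts. Degrees are tracked
  -- separately, in `Partial`.
  record Layout (m : ℕ) : Set where
    field
      graph     : Graph (suc m)
      connected : Connected graph
      loc       : Fin n → Fin (suc m)
      bridge    : ∀ {a b} → E graph a b → Bridge graph a b
      narrow    : ∀ {a b} (e : E graph a b) →
                  sw≤ G (λ v → side (bridge e) (loc v) ≡ true) k

  open Layout

  trivial : Layout 0
  trivial = record
    { graph     = record { adj = λ _ _ → false ; sym = λ _ _ → refl ; irrefl = λ _ → refl }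
    ; connected = λ { zero zero → [] }
    ; loc       = λ _ → zero
    ; bridge    = λ ()
    ; narrow    = λ ()
    }

  module _ {m} (L : Layout m) (x : Fin (suc m)) {Q : Fin n → Set} (Q? : Decidable Q) where

    loc⁺ : Fin n → Fin (suc (suc m))
    loc⁺ v = if does (Q? v) then zero else suc (loc L v)

    loc⁺-in : ∀ {v} → Q v → loc⁺ v ≡ zero
    loc⁺-in {v} q rewrite dec-true (Q? v) q = refl

    loc⁺-out : ∀ {v} → ¬ Q v → loc⁺ v ≡ suc (loc L v)
    loc⁺-out {v} ¬q rewrite dec-false (Q? v) ¬q = refl

    -- The vertices of `Q` move from `x` to a new pendant neighbour of `x`. Old cuts do not change,
    -- because the pendant has the colour of `x` in every old bridge; the new edge cuts off exactly
    -- `Q`.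
    detach : (∀ {v} → Q v → loc L v ≡ x) → sw≤ G Q k → Layout (suc m)
    detach Q⊆x swQ = record
      { graph     = H⁺
      ; connected = pendant-connected H x (connected L)
      ; loc       = loc⁺
      ; bridge    = λ {a} {b} → bridge⁺ a b
      ; narrow    = λ {a} {b} → narrow⁺ a b
      }
      where
      H  = graph L
      H⁺ = pendant H x
      β₀ = pendant-bridge H x

      bridge⁺ : ∀ a b → E H⁺ a b → Bridge H⁺ a b
      bridge⁺ zero    (suc b) e with does⇒≡ {x = x} e
      ... | refl = β₀
      bridge⁺ (suc a) zero    e with does⇒≡ {x = x} e
      ... | refl = reverse β₀
      bridge⁺ (suc a) (suc b) e = lift-bridge H x (bridge L e)

      side-new : ∀ v → (Q v × side β₀ (loc⁺ v) ≡ true) ⊎ (¬ Q v × side β₀ (loc⁺ v) ≡ false)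
      side-new v with Q? v
      ... | yes q = inj₁ (q , refl)
      ... | no ¬q = inj₂ (¬q , refl)

      side-old : ∀ {a b} (β : Bridge H a b) v →
                 side (lift-bridge H x β) (loc⁺ v) ≡ side β (loc L v)
      side-old β v with Q? v
      ... | yes q = cong (side β) (≡-sym (Q⊆x q))
      ... | no _  = refl

      Q≐ : Q ≐ (λ v → side β₀ (loc⁺ v) ≡ true)
      Q≐ = (λ {v} q → [ proj₂ , (λ (¬q , _) → contradiction q ¬q) ]′ (side-new v))
         , (λ {v} s → [ proj₁ , (λ (_ , s′) → contradiction (trans (≡-sym s) s′) λ ()) ]′
                        (side-new v))

      ∁Q≐ : ∁ Q ≐ (λ v → not (side β₀ (loc⁺ v)) ≡ true)
      ∁Q≐ = (λ {v} ¬q → [ (λ (q , _) → contradiction q ¬q) , cong not ∘ proj₂ ]′ (side-new v))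
          , (λ {v} s → [ (λ (_ , s′) → contradiction (trans (≡-sym s) (cong not s′)) λ ())
                       , proj₁ ]′ (side-new v))

      narrow⁺ : ∀ a b (e : E H⁺ a b) →
                sw≤ G (λ v → side (bridge⁺ a b e) (loc⁺ v) ≡ true) k
      narrow⁺ zero    (suc b) e with does⇒≡ {x = x} e
      ... | refl = sw≤-resp Q≐ swQ
      narrow⁺ (suc a) zero    e with does⇒≡ {x = x} e
      ... | refl = sw≤-resp ∁Q≐ (sw≤-∁ Q? swQ)
      narrow⁺ (suc a) (suc b) e = sw≤-resp
        ( (λ {v} s → trans (side-old (bridge L e) v) s)
        , (λ {v} s → trans (≡-sym (side-old (bridge L e) v)) s)) (narrow L e)

  -- Leaves are allowed degree 0 to cover the one-vertex graph, whose tree is a single node.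
  layout⇒simWidth : ∀ {m} (L : Layout m) →
    (∀ x → (degree (graph L) x ≤ 1 × ∃[ v ] loc L v ≡ x) ⊎ degree (graph L) x ≡ 3) →
    (∀ v → degree (graph L) (loc L v) ≤ 1) →
    (∀ {u v} → loc L u ≡ loc L v → u ≡ v) →
    SimWidth≤ G k
  layout⇒simWidth {m} L status leaf inj = B , λ a b e → sw≤-resp
    ( (λ {v} s → side⇒walk (bridge L e) (connected L (loc L v) a) s)
    , (λ (w , av) → walk⇒side (bridge L e) w av)) (narrow L e)
    where
    B : BranchDecomposition G
    B = record
      { tree     = record { size = m ; graph = graph L ; connected = connected L
                          ; acyclic = bridges⇒acyclic (bridge L) }
      ; internal = λ s ¬leaf → [ (λ (d , _) → contradiction d ¬leaf) , id ]′ (status s)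
      ; δ        = loc L
      ; δ-inj    = inj
      ; δ-leaf   = leaf
      ; δ-onto   = λ s d → [ proj₂ , (λ d₃ → contradiction (subst (_≤ 1) d₃ d) λ { (s≤s ()) }) ]′
                           (status s)
      }

  -- Binary hierarchies of clusters, realised as cubic trees.

  data Hierarchy (P : Fin n → Set) : Set₁ where
    leaf : ∀ v → P v → (∀ u → P u → u ≡ v) → sw≤ G P k → Hierarchy P
    node : ∀ {Q R} → Hierarchy Q → Hierarchy R → P ≐ Q ∪ R → (∀ v → Q v → ¬ R v) →
           sw≤ G P k → Hierarchy P

  width : ∀ {P} → Hierarchy P → sw≤ G P k
  width (leaf _ _ _ h)   = h
  width (node _ _ _ _ h) = h

  witness : ∀ {P} → Hierarchy P → ∃ P
  witness (leaf v p _ _)               = v , p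
  witness (node hQ _ (_ , P⊇Q∪R) _ _) = let v , q = witness hQ in v , P⊇Q∪R (inj₁ q)

  Hierarchy-resp : ∀ {P P′} → P ≐ P′ → Hierarchy P → Hierarchy P′
  Hierarchy-resp eq@(to , from) (leaf v p uniq h) =
    leaf v (to p) (λ u → uniq u ∘ from) (sw≤-resp eq h)
  Hierarchy-resp eq@(to , from) (node hQ hR (⊆QR , ⊇QR) dis h) =
    node hQ hR (⊆QR ∘ from , to ∘ ⊇QR) dis (sw≤-resp eq h)

  -- The index `_~_` is the relation of sharing a node. It describes how far the tree has been
  -- refined without mentioning its nodes, whose numbering shifts with each pendant.
  record Partial (_~_ : Fin n → Fin n → Set) : Set where
    field
      {m}      : ℕ
      layout   : Layout m
      status   : ∀ x → (degree (graph layout) x ≡ 1 × ∃[ v ] loc layout v ≡ x)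
                       ⊎ degree (graph layout) x ≡ 3
      loc-leaf : ∀ v → degree (graph layout) (loc layout v) ≡ 1
      loc⇒~    : ∀ {u v} → loc layout u ≡ loc layout v → u ~ v
      ~⇒loc    : ∀ {u v} → u ~ v → loc layout u ≡ loc layout v

  open Partial

  Partial-resp : ∀ {_~_ _≈_ : Fin n → Fin n → Set} → (∀ {u v} → u ~ v → u ≈ v) →
                 (∀ {u v} → u ≈ v → u ~ v) → Partial _~_ → Partial _≈_
  Partial-resp to from S = record
    { layout = layout S ; status = status S ; loc-leaf = loc-leaf S
    ; loc⇒~ = to ∘ loc⇒~ S ; ~⇒loc = ~⇒loc S ∘ from }

  Same : (Fin n → Set) → Fin n → Fin n → Set
  Same Q u v = (Q u → Q v) × (Q v → Q u)

  -- By the two hypotheses on `_~_`, `P` is the set of all vertices at one leaf. Pendants for `Q`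
  -- and `R` empty that leaf and raise its degree from 1 to 3. Inside `P`, failing `Q` means lying
  -- in `R`, so intersecting with `Same Q` describes the new positions.
  split : ∀ {_~_} {P Q R : Fin n → Set} → P ≐ Q ∪ R → (∀ v → Q v → ¬ R v) → ∃ Q → ∃ R →
          sw≤ G Q k → sw≤ G R k →
          (∀ {u} → P u → ∀ {v} → P v → u ~ v) → (∀ {u} → P u → ∀ {v} → u ~ v → P v) →
          Partial _~_ → Partial (λ u v → u ~ v × Same Q u v)
  split {_~_} {P} {Q} {R} (⊆QR , ⊇QR) dis (vQ , qQ) (vR , rR) swQ swR P⇒~ ~⇒P S = record
    { layout   = L₂
    ; status   = status₂
    ; loc-leaf = leaf₂
    ; loc⇒~    = λ {u} {v} → loc⇒ u v
    ; ~⇒loc    = λ {u} {v} → ⇒loc u v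
    }
    where
    L = layout S
    x = loc L vQ
    PvQ = ⊇QR (inj₁ qQ)

    P⇒x : ∀ {v} → P v → loc L v ≡ x
    P⇒x p = ≡-sym (~⇒loc S (P⇒~ PvQ p))

    x⇒P : ∀ {v} → loc L v ≡ x → P v
    x⇒P eq = ~⇒P PvQ (loc⇒~ S (≡-sym eq))

    -- The clusters come without decision procedures. Membership in `P` is read off from the
    -- position in the tree, and the cover by `Q` and `R` then decides those two.
    P? : Decidable P
    P? v with loc L v ≟ x
    ... | yes eq = yes (x⇒P eq)
    ... | no ¬eq = no (¬eq ∘ P⇒x)

    Q? : Decidable Q
    Q? v with P? v
    ... | no ¬p = no (¬p ∘ ⊇QR ∘ inj₁)
    ... | yes p with ⊆QR p
    ...   | inj₁ q = yes q
    ...   | inj₂ r = no λ q → dis v q r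

    R? : Decidable R
    R? v with P? v
    ... | no ¬p = no (¬p ∘ ⊇QR ∘ inj₂)
    ... | yes p with ⊆QR p
    ...   | inj₁ q = no (dis v q)
    ...   | inj₂ r = yes r

    Q⊆x : ∀ {v} → Q v → loc L v ≡ x
    Q⊆x = P⇒x ∘ ⊇QR ∘ inj₁

    L₁ = detach L x Q? Q⊆x swQ

    R⊆x : ∀ {v} → R v → loc L₁ v ≡ suc x
    R⊆x {v} r = trans (loc⁺-out L x Q? (λ q → dis v q r)) (cong suc (P⇒x (⊇QR (inj₂ r))))

    -- The first pendant has shifted `x` to `suc x`. After the second shift `R` sits at `zero`, `Q`
    -- at `suc zero`, and the new internal node is `suc (suc x)`.
    L₂ = detach L₁ (suc x) R? R⊆x swR

    data Place (v : Fin n) : Set where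
      inQ   : loc L v ≡ x → Q v → ¬ R v → loc L₂ v ≡ suc zero → Place v
      inR   : loc L v ≡ x → ¬ Q v → R v → loc L₂ v ≡ zero → Place v
      stays : loc L v ≢ x → ¬ Q v → ¬ R v → loc L₂ v ≡ suc (suc (loc L v)) → Place v

    place : ∀ v → Place v
    place v with P? v
    ... | no ¬p = stays (¬p ∘ x⇒P) ¬q ¬r
      (trans (loc⁺-out L₁ (suc x) R? ¬r) (cong suc (loc⁺-out L x Q? ¬q)))
      where ¬q = ¬p ∘ ⊇QR ∘ inj₁
            ¬r = ¬p ∘ ⊇QR ∘ inj₂
    ... | yes p with ⊆QR p
    ...   | inj₁ q = inQ (P⇒x p) q (dis v q)
      (trans (loc⁺-out L₁ (suc x) R? (dis v q)) (cong suc (loc⁺-in L x Q? q)))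
    ...   | inj₂ r = inR (P⇒x p) (λ q → dis v q r) r (loc⁺-in L₁ (suc x) R? r)

    loc⇒ : ∀ u v → loc L₂ u ≡ loc L₂ v → (u ~ v) × Same Q u v
    loc⇒ u v eq with place u | place v
    ... | inQ p q _ _    | inQ p′ q′ _ _  =
      loc⇒~ S (trans p (≡-sym p′)) , (λ _ → q′) , (λ _ → q)
    ... | inR p ¬q _ _   | inR p′ ¬q′ _ _ =
      loc⇒~ S (trans p (≡-sym p′)) , (λ q → contradiction q ¬q) , (λ q → contradiction q ¬q′)
    ... | stays _ ¬q _ h | stays _ ¬q′ _ h′ =
      loc⇒~ S (suc-injective (suc-injective (trans (≡-sym h) (trans eq h′)))) ,
      (λ q → contradiction q ¬q) , (λ q → contradiction q ¬q′)
    ... | inQ _ _ _ h    | inR _ _ _ h′   = contradiction (trans (≡-sym h) (trans eq h′)) λ ()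
    ... | inQ _ _ _ h    | stays _ _ _ h′ = contradiction (trans (≡-sym h) (trans eq h′)) λ ()
    ... | inR _ _ _ h    | inQ _ _ _ h′   = contradiction (trans (≡-sym h) (trans eq h′)) λ ()
    ... | inR _ _ _ h    | stays _ _ _ h′ = contradiction (trans (≡-sym h) (trans eq h′)) λ ()
    ... | stays _ _ _ h  | inQ _ _ _ h′   = contradiction (trans (≡-sym h) (trans eq h′)) λ ()
    ... | stays _ _ _ h  | inR _ _ _ h′   = contradiction (trans (≡-sym h) (trans eq h′)) λ ()

    ⇒loc : ∀ u v → (u ~ v) × Same Q u v → loc L₂ u ≡ loc L₂ v
    ⇒loc u v (u~v , Qu⇒ , Qv⇒) with place u | place v | ~⇒loc S u~v
    ... | inQ _ _ _ h   | inQ _ _ _ h′   | _  = trans h (≡-sym h′)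
    ... | inR _ _ _ h   | inR _ _ _ h′   | _  = trans h (≡-sym h′)
    ... | stays _ _ _ h | stays _ _ _ h′ | eq = trans h (trans (cong (λ y → suc (suc y)) eq) (≡-sym h′))
    ... | inQ _ q _ _   | inR _ ¬q _ _   | _  = contradiction (Qu⇒ q) ¬q
    ... | inQ _ q _ _   | stays _ ¬q _ _ | _  = contradiction (Qu⇒ q) ¬q
    ... | inR _ ¬q _ _  | inQ _ q _ _    | _  = contradiction (Qv⇒ q) ¬q
    ... | inR p _ _ _   | stays ¬p _ _ _ | eq = contradiction (trans (≡-sym eq) p) ¬p
    ... | stays _ ¬q _ _ | inQ _ q _ _   | _  = contradiction (Qv⇒ q) ¬q
    ... | stays ¬p _ _ _ | inR p _ _ _   | eq = contradiction (trans eq p) ¬p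

    H₁ = graph L₁
    H₂ = graph L₂

    degree-zero : degree H₂ zero ≡ 1
    degree-zero = degree-pendant H₁ (suc x)

    degree-one : degree H₂ (suc zero) ≡ 1
    degree-one = trans (degree-other H₁ (suc x) {zero} λ ()) (degree-pendant (graph L) x)

    degree-x : degree H₂ (suc (suc x)) ≡ 3
    degree-x = trans (degree-support H₁ (suc x))
      (cong suc (trans (degree-support (graph L) x) (cong suc (loc-leaf S vQ))))

    degree-old : ∀ {y} → y ≢ x → degree H₂ (suc (suc y)) ≡ degree (graph L) y
    degree-old y≢x = trans (degree-other H₁ (suc x) (y≢x ∘ suc-injective))
                           (degree-other (graph L) x y≢x)

    leaf₂ : ∀ v → degree H₂ (loc L₂ v) ≡ 1
    leaf₂ v with place v
    ... | inQ _ _ _ h    = trans (cong (degree H₂) h) degree-one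
    ... | inR _ _ _ h    = trans (cong (degree H₂) h) degree-zero
    ... | stays ¬p _ _ h = trans (cong (degree H₂) h) (trans (degree-old ¬p) (loc-leaf S v))

    status₂ : ∀ y → (degree H₂ y ≡ 1 × ∃[ v ] loc L₂ v ≡ y) ⊎ degree H₂ y ≡ 3
    status₂ zero       = inj₁ (degree-zero , vR , loc⁺-in L₁ (suc x) R? rR)
    status₂ (suc zero) = inj₁ (degree-one , vQ ,
      trans (loc⁺-out L₁ (suc x) R? (dis vQ qQ)) (cong suc (loc⁺-in L x Q? qQ)))
    status₂ (suc (suc y)) with y ≟ x
    ... | yes refl = inj₂ degree-x
    ... | no y≢x with status S y
    ...   | inj₂ d = inj₂ (trans (degree-old y≢x) d)
    ...   | inj₁ (d , v , refl) with place v
    ...     | inQ p _ _ _   = contradiction p y≢x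
    ...     | inR p _ _ _   = contradiction p y≢x
    ...     | stays _ _ _ h = inj₁ (trans (degree-old y≢x) d , v , h)

  -- Split the leaf holding `P`, then refine its two halves in turn. The clause on `P u` says that
  -- `P` has been broken into singletons; it is symmetric in effect, since `P` is a class of `_~_`.
  refine : ∀ {_~_ P} → Hierarchy P →
           (∀ {u} → P u → ∀ {v} → P v → u ~ v) → (∀ {u} → P u → ∀ {v} → u ~ v → P v) →
           Partial _~_ → Partial (λ u v → u ~ v × (P u → u ≡ v))
  refine (leaf w _ uniq _) P⇒~ ~⇒P S = Partial-resp
    (λ {u} {v} u~v → u~v , λ p → trans (uniq u p) (≡-sym (uniq v (~⇒P p u~v)))) proj₁ S
  refine {_~_} {P} (node {Q} {R} hQ hR PQR@(⊆QR , ⊇QR) dis _) P⇒~ ~⇒P S =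
    Partial-resp
      (λ { ((( u~v , _) , q) , r) → u~v , [ q , r ]′ ∘ ⊆QR })
      (λ { (u~v , p) → ((u~v , (λ q → subst Q (p (⊇QR (inj₁ q))) q)
                               , (λ q → subst Q (≡-sym (p (~⇒P (⊇QR (inj₁ q)) (~-sym u~v)))) q))
                       , p ∘ ⊇QR ∘ inj₁) , p ∘ ⊇QR ∘ inj₂ })
      S₃
    where
    ~-sym : ∀ {u v} → u ~ v → v ~ u
    ~-sym = loc⇒~ S ∘ ≡-sym ∘ ~⇒loc S

    S₁ = split PQR dis (witness hQ) (witness hR) (width hQ) (width hR) P⇒~ ~⇒P S

    S₂ = refine hQ
      (λ q q′ → P⇒~ (⊇QR (inj₁ q)) (⊇QR (inj₁ q′)) , (λ _ → q′) , (λ _ → q))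
      (λ q (_ , Q⇒ , _) → Q⇒ q) S₁

    -- Refining `Q` has left `R` a single class: the clauses about `Q` are vacuous on `R`, which is
    -- disjoint from it.
    S₃ = refine hR
      (λ {u} r {v} r′ → (P⇒~ (⊇QR (inj₂ r)) (⊇QR (inj₂ r′)) ,
                         (λ q → contradiction r (dis u q)) , (λ q → contradiction r′ (dis v q))) ,
                        (λ q → contradiction r (dis u q)))
      (λ {u} r ((u~v , _ , Q⇐) , _) →
        [ (λ q → contradiction r (dis u (Q⇐ q))) , id ]′ (⊆QR (~⇒P (⊇QR (inj₂ r)) u~v)))
      S₂

  hierarchy⇒simWidth : ∀ {P} → (∀ v → P v) → Hierarchy P → SimWidth≤ G k
  hierarchy⇒simWidth all (leaf v _ uniq _) = layout⇒simWidth trivial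
    (λ { zero → inj₁ (z≤n , v , refl) }) (λ _ → z≤n)
    (λ {u} {w} _ → trans (uniq u (all u)) (≡-sym (uniq w (all w))))
  hierarchy⇒simWidth all (node {Q} {R} hQ hR (⊆QR , _) dis _) =
    layout⇒simWidth (layout S) (λ x → Sum.map₁ (λ (d , v) → ≤-reflexive d , v) (status S x))
      (≤-reflexive ∘ loc-leaf S)
      (λ {u} eq → let (_ , q) , r = loc⇒~ S eq in [ q , r ]′ (⊆QR (all u)))
    where
    Q? : Decidable Q
    Q? v with ⊆QR (all v)
    ... | inj₁ q = yes q
    ... | inj₂ r = no λ q → dis v q r

    -- The root of the hierarchy gets no node of its own, as that node would have degree 2. Its two
    -- halves start at the ends of a single edge.
    L₁ = detach trivial zero Q? (λ _ → refl) (width hQ)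

    S₁ : Partial (Same Q)
    S₁ = record
      { layout   = L₁
      ; status   = λ { zero       → inj₁ (refl , proj₁ (witness hQ) ,
                                          loc⁺-in trivial zero Q? (proj₂ (witness hQ)))
                     ; (suc zero) → inj₁ (refl , proj₁ (witness hR) ,
                                          loc⁺-out trivial zero Q? λ q → dis _ q (proj₂ (witness hR))) }
      ; loc-leaf = λ v → degree-one (loc L₁ v)
      ; loc⇒~    = λ {u} {v} → loc⇒ u v
      ; ~⇒loc    = λ {u} {v} → ⇒loc u v
      }
      where
      degree-one : ∀ x → degree (graph L₁) x ≡ 1
      degree-one zero       = refl
      degree-one (suc zero) = refl
      loc⇒ : ∀ u v → loc L₁ u ≡ loc L₁ v → Same Q u v
      loc⇒ u v eq with Q? u | Q? v
      ... | yes q | yes q′ = (λ _ → q′) , (λ _ → q)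
      ... | no ¬q | no ¬q′ = (λ q → contradiction q ¬q) , (λ q → contradiction q ¬q′)
      loc⇒ u v () | yes _ | no _
      loc⇒ u v () | no _ | yes _
      ⇒loc : ∀ u v → Same Q u v → loc L₁ u ≡ loc L₁ v
      ⇒loc u v (Q⇒ , Q⇐) with Q? u | Q? v
      ... | yes _ | yes _ = refl
      ... | no _  | no _  = refl
      ... | yes q | no ¬q = contradiction (Q⇒ q) ¬q
      ... | no ¬q | yes q = contradiction (Q⇐ q) ¬q

    S = refine hR
      (λ {u} r {v} r′ → ((λ q → contradiction r (dis u q)) , (λ q → contradiction r′ (dis v q))) ,
                        (λ q → contradiction r (dis u q)))
      (λ {u} r {v} ((_ , Q⇐) , _) → [ (λ q → contradiction r (dis u (Q⇐ q))) , id ]′ (⊆QR (all v)))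
      (refine hQ (λ q q′ → (λ _ → q′) , (λ _ → q)) (λ q (Q⇒ , _) → Q⇒ q) S₁)

-- Non-backtracking walks

module _ {m} (H : Graph m) (w : ℕ → Fin m) (step : ∀ i → E H (w i) (w (suc i)))
         (nonbacktracking : ∀ i → w i ≢ w (suc (suc i))) where

  -- Induction on the length `d` of a closed stretch of the walk. A repetition inside it gives a
  -- shorter closed stretch. Without one, length 1 would be a loop and length 2 a backtrack, so the
  -- stretch is a cycle.
  closed⇒cycle : ∀ i d → Acc _<_ d → 0 < d → w i ≡ w (i + d) → Cycle H
  closed⇒cycle i d (acc rec) 0<d closed
    with any? (λ (a : Fin d) → any? (λ (b : Fin d) →
           ¬? (a ≟ b) ×-dec (w (i + toℕ a) ≟ w (i + toℕ b))))
  ... | yes (a , b , a≢b , wa≡wb) = case <-cmp (toℕ a) (toℕ b) of λ where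
      (tri< a<b _ _) → shorten a b a<b wa≡wb
      (tri≈ _ a≡b _) → contradiction (toℕ-injective a≡b) a≢b
      (tri> _ _ b<a) → shorten b a b<a (≡-sym wa≡wb)
    where
    shorten : (a b : Fin d) → toℕ a < toℕ b → w (i + toℕ a) ≡ w (i + toℕ b) → Cycle H
    shorten a b a<b eq = closed⇒cycle (i + toℕ a) (toℕ b ∸ toℕ a)
      (rec (≤-<-trans (m∸n≤m (toℕ b) (toℕ a)) (toℕ<n b))) (m<n⇒0<n∸m a<b)
      (trans eq (cong w (trans (cong (i +_) (≡-sym (m+[n∸m]≡n (<⇒≤ a<b))))
                               (≡-sym (+-assoc i (toℕ a) _)))))
  closed⇒cycle i 1 _ _ closed | no _ =
    contradiction (trans closed (cong w (trans (+-suc i 0) (cong suc (+-identityʳ i)))))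
                  (E⇒≢ H (step i))
  closed⇒cycle i 2 _ _ closed | no _ =
    contradiction (trans closed (cong w (trans (+-suc i 1)
                    (cong suc (trans (+-suc i 0) (cong suc (+-identityʳ i)))))))
                  (nonbacktracking i)
  closed⇒cycle i (suc (suc (suc d))) _ _ closed | no ¬repeat = record
    { m       = d
    ; c       = λ a → w (i + toℕ a)
    ; inj     = λ {a} {b} eq → decidable-stable (a ≟ b) λ a≢b → ¬repeat (a , b , a≢b , eq)
    ; steps   = λ a → subst₂ (λ x y → E H (w x) (w y))
                        (cong (i +_) (≡-sym (toℕ-inject₁ a))) (≡-sym (+-suc i (toℕ a)))
                        (step (i + toℕ a))
    ; closing = subst₂ (E H) (cong (λ a → w (i + a)) (≡-sym (toℕ-fromℕ (suc (suc d)))))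
                  (trans (cong w (≡-sym (+-suc i (suc (suc d)))))
                         (trans (≡-sym closed) (cong w (≡-sym (+-identityʳ i)))))
                  (step (i + suc (suc d)))
    }

  nonbacktracking⇒cycle : Cycle H
  nonbacktracking⇒cycle with pigeonhole (n<1+n m) (w ∘ toℕ)
  ... | a , b , a<b , eq = closed⇒cycle (toℕ a) (toℕ b ∸ toℕ a) (<-wellFounded _) (m<n⇒0<n∸m a<b)
    (trans eq (cong w (≡-sym (m+[n∸m]≡n (<⇒≤ a<b)))))

module _ {m} (H : Graph m) (Live : Fin m → Set)
         (next : ∀ a p → Live a → Live p → a ≢ p → ∃[ b ] (Live b × E H a b × b ≢ p)) where

  private
    -- The state of the walk is its last directed edge: the tail is the vertex that the next step
    -- has to avoid.
    Arc : Set
    Arc = Σ (Fin m × Fin m) λ (x , y) → Live x × Live y × E H x y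

    advance : Arc → Arc
    advance ((x , y) , lx , ly , e) =
      let z , lz , e′ , _ = next y x ly lx (E⇒≢ H (E-sym H e)) in (y , z) , ly , lz , e′

    advance-≢ : ∀ t → proj₁ (proj₁ t) ≢ proj₂ (proj₁ (advance t))
    advance-≢ ((x , y) , lx , ly , e) =
      let _ , _ , _ , z≢x = next y x ly lx (E⇒≢ H (E-sym H e)) in z≢x ∘ ≡-sym

    iterate : Arc → ℕ → Arc
    iterate t zero    = t
    iterate t (suc i) = advance (iterate t i)

  branching⇒cycle : ∀ {a p} → Live a → Live p → a ≢ p → Cycle H
  branching⇒cycle {a} {p} la lp a≢p = nonbacktracking⇒cycle H (proj₁ ∘ proj₁ ∘ t)
    (λ i → proj₂ (proj₂ (proj₂ (t i)))) (λ i → advance-≢ (t i))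
    where
    t : ℕ → Arc
    -- For the first arc another live vertex, `p`, stands in for the predecessor.
    t = let b , lb , e , _ = next a p la lp a≢p in iterate ((a , b) , la , lb , e)

-- Contracting the tree decomposition

module _ {n} (G : Graph n) (D : TreeDecomposition G) (k : ℕ)
         (narrow : ∀ s → μ≤ G (TreeDecomposition.bag D s) k) where

  open TreeDecomposition D
  open Tree tree

  -- An edge missing `bag s` cannot leave `P`, so every matching across `P` touches the bag and
  -- `narrow s` applies to it.
  separated⇒sw≤ : ∀ s {P : Fin n → Set} →
    (∀ {x y} → E G x y → x ∉ˢ bag s → y ∉ˢ bag s → P x → P y) → sw≤ G P k
  separated⇒sw≤ s {P} closed m M crosses = narrow s m M touches
    where
    touches : Touches M (bag s)
    touches i with u M i ∈ˢ? bag s | w M i ∈ˢ? bag s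
    ... | yes u∈ | _      = inj₁ u∈
    ... | no _   | yes w∈ = inj₂ w∈
    ... | no u∉  | no w∉ with crosses i
    ...   | inj₁ (Pu , ¬Pw) = contradiction (closed (isEdge M i) u∉ w∉ Pu) ¬Pw
    ...   | inj₂ (Pw , ¬Pu) = contradiction (closed (E-sym G (isEdge M i)) w∉ u∉ Pw) ¬Pu

  ⊆bag⇒sw≤ : ∀ s {P : Fin n → Set} → (∀ {x} → P x → x ∈ˢ bag s) → sw≤ G P k
  ⊆bag⇒sw≤ s P⊆ = separated⇒sw≤ s λ _ x∉ _ Px → contradiction (P⊆ Px) x∉

  home : Fin n → Node
  home v = proj₁ (nonempty v)

  -- A hierarchy is never empty, but a part of the tree may be the home of no vertex.
  Optional : (Fin n → Set) → Set₁
  Optional P = (∀ v → ¬ P v) ⊎ Hierarchy G k P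

  Optional-resp : ∀ {P P′ : Fin n → Set} → P ≐ P′ → Optional P → Optional P′
  Optional-resp (to , from) (inj₁ none) = inj₁ λ v → none v ∘ from
  Optional-resp eq          (inj₂ h)    = inj₂ (Hierarchy-resp G k eq h)

  Optional-∪ : ∀ {P Q R : Fin n → Set} → P ≐ Q ∪ R → (∀ v → Q v → ¬ R v) → sw≤ G P k →
               Optional Q → Optional R → Optional P
  Optional-∪ eq dis h (inj₂ hQ) (inj₂ hR) = inj₂ (node hQ hR eq dis h)
  Optional-∪ (⊆QR , ⊇QR) dis h (inj₁ none) r =
    Optional-resp (⊇QR ∘ inj₂ , λ {v} p → [ (λ q → contradiction q (none v)) , id ]′ (⊆QR p)) r
  Optional-∪ (⊆QR , ⊇QR) dis h q@(inj₂ _) (inj₁ none) =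
    Optional-resp (⊇QR ∘ inj₁ , λ {v} p → [ id , (λ r → contradiction r (none v)) ]′ (⊆QR p)) q

  -- Peeling off one vertex at a time gives a caterpillar. All its clusters lie inside `bag s`, so
  -- any matching across one of them touches the bag.
  inBag : ∀ s {P : Fin n → Set} → Decidable P → (∀ {x} → P x → x ∈ˢ bag s) → Optional P
  inBag s {P} P? P⊆ = Optional-resp (proj₂ , λ {v} p → ∈-allFin v , p) (go (allFin n))
    where
    open import Data.List.Membership.DecPropositional (_≟_ {n}) using (_∈?_)

    go : ∀ vs → Optional (λ v → v ∈ vs × P v)
    go [] = inj₁ λ _ ()
    -- The test against `vs` makes the singleton disjoint from the remaining cluster, whatever the
    -- list.
    go (v ∷ vs) with P? v ×-dec ¬? (v ∈? vs)
    ... | yes (Pv , v∉vs) = Optional-∪ {λ u → u ∈ v ∷ vs × P u} {_≡ v} {λ u → u ∈ vs × P u}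
      ( (λ { (here refl , _) → inj₁ refl ; (there v∈ , p) → inj₂ (v∈ , p) })
      , (λ { (inj₁ refl) → here refl , Pv ; (inj₂ (v∈ , p)) → there v∈ , p }))
      (λ { _ refl (v∈vs , _) → v∉vs v∈vs })
      (⊆bag⇒sw≤ s {λ u → u ∈ v ∷ vs × P u} (P⊆ ∘ proj₂))
      (inj₂ (leaf v refl (λ _ → id) (⊆bag⇒sw≤ s {_≡ v} λ { refl → P⊆ Pv })))
      (go vs)
    ... | no ¬new = Optional-resp
      ( (λ (v∈ , p) → there v∈ , p)
      , (λ { (there v∈ , p) → v∈ , p
           ; (here refl , p) → decidable-stable (v ∈? vs) (λ v∉ → ¬new (p , v∉)) , p }))
      (go vs)

  -- The nodes s with c s ≡ s represent the parts of T contracted so far; tree edges between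
  -- two parts join their representatives.
  record Contraction (c : Node → Node) : Set where
    field
      idem    : ∀ s → c (c s) ≡ c s
      between : ∀ {s t} → E graph s t → c s ≡ c t ⊎ (c s ≡ s × c t ≡ t)

  open Contraction

  discrete : Contraction id
  discrete = record
    { idem    = λ _ → refl
    ; between = λ _ → inj₂ (refl , refl)
    }

  Part : (Node → Node) → Node → Fin n → Set
  Part c p v = c (home v) ≡ p

  discrete-parts : ∀ p → Optional (Part id p)
  discrete-parts p = inBag p (λ v → home v ≟ p) λ { {v} refl → proj₂ (nonempty v) }

  part-sw≤ : ∀ {c} → Contraction c → ∀ p → sw≤ G (Part c p) k
  part-sw≤ {c} C p = separated⇒sw≤ p closed
    where
    follow : ∀ {x a b} → x ∉ˢ bag p → (w : Walk graph a b) → AllOn (λ s → x ∈ˢ bag s) w →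
             c a ≡ p → c b ≡ p
    follow x∉ []      _        ca≡p = ca≡p
    follow x∉ (e ∷ w) (x∈ , on) ca≡p with between C e
    ... | inj₁ eq         = follow x∉ w on (trans (≡-sym eq) ca≡p)
    -- A tree edge leading to another part starts at the representative, so the walk visits `p`
    -- itself and `x` lies in its bag.
    ... | inj₂ (ca≡a , _) =
      contradiction (subst (λ s → _ ∈ˢ bag s) (trans (≡-sym ca≡a) ca≡p) x∈) x∉

    closed : ∀ {x y} → E G x y → x ∉ˢ bag p → y ∉ˢ bag p → c (home x) ≡ p → c (home y) ≡ p
    -- Walk from `home x` to a common bag along nodes containing `x`, then on to `home y` along
    -- nodes containing `y`. Neither stretch can leave the part.
    closed {x} {y} e x∉ y∉ =
      let s , x∈s , y∈s = edgeCov x y e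
          wx , onx = coherent x (home x) s (proj₂ (nonempty x)) x∈s
          wy , ony = coherent y s (home y) y∈s (proj₂ (nonempty y))
      in follow y∉ wy ony ∘ follow x∉ wx onx

  module _ {c} (C : Contraction c) {ℓ p} (cℓ : c ℓ ≡ ℓ) (cp : c p ≡ p) (ℓ≢p : ℓ ≢ p)
           (only : ∀ q → c q ≡ q → E graph ℓ q → q ≡ p) where

    merge : Node → Node
    merge q = if does (q ≟ ℓ) then p else q

    merge-ℓ : merge ℓ ≡ p
    merge-ℓ rewrite dec-true (ℓ ≟ ℓ) refl = refl

    merge-other : ∀ {q} → q ≢ ℓ → merge q ≡ q
    merge-other {q} q≢ℓ rewrite dec-false (q ≟ ℓ) q≢ℓ = refl

    merge≢ℓ : ∀ q → merge q ≢ ℓ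
    merge≢ℓ q with q ≟ ℓ
    ... | yes _  = ℓ≢p ∘ ≡-sym
    ... | no q≢ℓ = q≢ℓ

    merge⁻¹ : ∀ {q r} → merge q ≡ r → r ≢ p → q ≡ r
    merge⁻¹ {q} eq r≢p with q ≟ ℓ
    ... | yes _ = contradiction (≡-sym eq) r≢p
    ... | no _  = eq

    merge⁻¹-p : ∀ {q} → merge q ≡ p → q ≡ p ⊎ q ≡ ℓ
    merge⁻¹-p {q} eq with q ≟ ℓ
    ... | yes q≡ℓ = inj₂ q≡ℓ
    ... | no _    = inj₁ eq

    c′ : Node → Node
    c′ = merge ∘ c

    c′-p : c′ p ≡ p
    c′-p = trans (cong merge cp) (merge-other (ℓ≢p ∘ ≡-sym))

    idem′ : ∀ s → c′ (c′ s) ≡ c′ s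
    idem′ s with c s ≟ ℓ
    ... | yes _ = c′-p
    ... | no cs≢ℓ = trans (cong merge (idem C s)) (merge-other cs≢ℓ)

    -- By `only`, an edge from `ℓ` to another part ends at `p` and becomes internal to the merged
    -- part. The other edges between parts keep both their ends as representatives.
    between′ : ∀ {s t} → E graph s t → c′ s ≡ c′ t ⊎ (c′ s ≡ s × c′ t ≡ t)
    between′ {s} {t} e with between C e
    ... | inj₁ eq = inj₁ (cong merge eq)
    ... | inj₂ (cs , ct) with s ≟ ℓ | t ≟ ℓ
    ...   | yes refl | _ = inj₁ (trans (trans (cong merge cs) merge-ℓ)
            (≡-sym (trans (cong c′ (only t ct e)) c′-p)))
    ...   | no _ | yes refl = inj₁ (trans
            (trans (cong c′ (only s cs (E-sym graph e))) c′-p)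
            (≡-sym (trans (cong merge ct) merge-ℓ)))
    ...   | no s≢ℓ | no t≢ℓ = inj₂ ( trans (cong merge cs) (merge-other s≢ℓ)
                                   , trans (cong merge ct) (merge-other t≢ℓ))

    contract : Contraction c′
    contract = record { idem = idem′ ; between = between′ }

    contract-parts : (∀ q → Optional (Part c q)) → ∀ q → Optional (Part c′ q)
    contract-parts parts q with q ≟ ℓ | q ≟ p
    ... | yes refl | _ = inj₁ λ v → merge≢ℓ (c (home v))
    ... | no _ | yes refl = Optional-∪ {Q = Part c p} {R = Part c ℓ}
      ( merge⁻¹-p
      , [ (λ eq → trans (cong merge eq) (merge-other (ℓ≢p ∘ ≡-sym)))
        , (λ eq → trans (cong merge eq) merge-ℓ) ]′)
      (λ _ eq eq′ → ℓ≢p (trans (≡-sym eq′) eq))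
      -- The bound for the union comes from the new contraction, not from the bounds of the two
      -- halves.
      (part-sw≤ contract p) (parts p) (parts ℓ)
    ... | no q≢ℓ | no q≢p = Optional-resp
      ( (λ eq → trans (cong merge eq) (merge-other q≢ℓ))
      , (λ eq → merge⁻¹ eq q≢p)) (parts q)

    contract-fixed : ∀ {s} → c′ s ≡ s → c s ≡ s
    contract-fixed {s} eq with s ≟ p
    ... | yes refl = cp
    ... | no s≢p   = merge⁻¹ eq s≢p

  -- Contraction down to a single part.

  live : (Node → Node) → Subset (suc size)
  live c = tabulate λ s → does (c s ≟ s)

  live⁺ : ∀ c {s} → c s ≡ s → s ∈ˢ live c
  live⁺ c {s} eq = lookup⇒[]= s (live c) (trans (lookup∘tabulate (λ t → does (c t ≟ t)) s)
                                                (dec-true (c s ≟ s) eq))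

  live⁻ : ∀ c {s} → s ∈ˢ live c → c s ≡ s
  live⁻ c {s} s∈ = does⇒≡ (trans (≡-sym (lookup∘tabulate (λ t → does (c t ≟ t)) s)) ([]=⇒lookup s∈))

  contractAll : ∀ {c} → Contraction c → (∀ p → Optional (Part c p)) → Acc _⊂_ (live c) →
                Fin n → SimWidth≤ G k
  contractAll {c} C parts (acc rec) v₀
    with any? (λ ℓ → any? (λ p → (c ℓ ≟ ℓ) ×-dec (c p ≟ p) ×-dec ¬? (ℓ ≟ p) ×-dec
                all? (λ q → (c q ≟ q) →-dec (adj graph ℓ q ≟ᵇ true) →-dec (q ≟ p))))
  ... | yes (ℓ , p , cℓ , cp , ℓ≢p , only) =
    let c⁺ = c′ C cℓ cp ℓ≢p only in
    contractAll (contract C cℓ cp ℓ≢p only) (contract-parts C cℓ cp ℓ≢p only parts)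
      -- The set of representatives loses `ℓ` and gains nothing.
      (rec ( (λ {s} s∈ → live⁺ c (contract-fixed C cℓ cp ℓ≢p only (live⁻ c⁺ s∈)))
           , ℓ , live⁺ c cℓ , (λ ℓ∈ → merge≢ℓ C cℓ cp ℓ≢p only (c ℓ) (live⁻ c⁺ ℓ∈)))) v₀
  ... | no ¬leaf = finish (parts r)
    where
    r = c (home v₀)

    next : ∀ a p → c a ≡ a → c p ≡ p → a ≢ p → ∃[ b ] (c b ≡ b × E graph a b × b ≢ p)
    next a p ca cp a≢p
      with ¬∀⟶∃¬ (suc size) _ (λ q → (c q ≟ q) →-dec (adj graph a q ≟ᵇ true) →-dec (q ≟ p))
             (λ only → ¬leaf (a , p , ca , cp , a≢p , only))
    ... | b , ¬h = b , decidable-stable (c b ≟ b) (λ ¬cb → ¬h λ cb → contradiction cb ¬cb)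
                     , decidable-stable (adj graph a b ≟ᵇ true)
                         (λ ¬e → ¬h λ _ e → contradiction e ¬e)
                     , λ b≡p → ¬h λ _ _ → b≡p

    -- As the search failed, every representative has a neighbouring representative different from
    -- any prescribed other one. A second representative besides `r` would thus force a cycle in the
    -- tree.
    all-in-r : ∀ v → Part c r v
    all-in-r v = decidable-stable (c (home v) ≟ r) λ v∉r → acyclic
      (branching⇒cycle graph (λ s → c s ≡ s) next (idem C (home v)) (idem C (home v₀)) v∉r)

    finish : Optional (Part c r) → SimWidth≤ G k
    finish (inj₁ none) = contradiction refl (none v₀)
    finish (inj₂ h)    = hierarchy⇒simWidth G k all-in-r h

theorem9 : ∀ (n : ℕ) (G : Graph (suc n)) (k : ℕ) → MMHW≡ G k → SimWidth≤ G k
theorem9 n G k ((D , narrow) , _) =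
  contractAll G D k narrow (discrete G D k narrow) (discrete-parts G D k narrow)
    -- The vertex `zero` exists since `G` has `suc n` vertices; it singles out the final part.
    (⊂-wellFounded _) zero
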